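{- Let $\mathbb{K}$ be a field of characteristic zero, let $\mathcal{A}=\{A_k(x)\}_{k\ge 0}$ be a sequence of Appell polynomials in $\mathbb{K}[x]$, and let $n$ be a non-negative integer. Then every semi-invariant $S(a_0,a_1,\ldots,a_n)\in\mathcal{S}_n$ defines an identity $$S(A_0(x),A_1(x),\ldots,A_n(x))=S(A_0(0),A_1(0),\ldots,A_n(0))$$ in $\mathbb{K}[x]$.
   Context: A sequence of Appell polynomials is a sequence $\{A_k(x)\}_{k\ge0}$ of polynomials in $\mathbb{K}[x]$ with $\deg A_k(x)=k$ and $A_k'(x)=kA_{k-1}(x)$ for all $k$ (so $A_0$ is a non-zero constant). $\mathcal{D}$ is the $\mathbb{K}$-linear derivation of $\mathbb{K}[a_0,a_1,\ldots,a_n]$ determined by $\mathcal{D}(a_i)=i\,a_{i-1}$ (so $\mathcal{D}(a_0)=0$). The algebra of semi-invariants of the generic binary form of order $n$ is $\mathcal{S}_n:=\ker\mathcal{D}\subset\mathbb{K}[a_0,\ldots,a_n]$. -}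

module Defs where

open import Algebra.Bundles using (CommutativeRing; Semiring)
open import Data.Bool.Base using (if_then_else_)
open import Data.Fin.Base as Fin using (Fin; toℕ)
open import Data.List.Base using (List; []; _∷_; _++_; map; length)
open import Data.Nat.Base as ℕ using (ℕ; zero; suc; pred)
open import Data.Product.Base using (_×_; _,_; ∃-syntax)
open import Data.Vec.Base as Vec using (Vec; replicate; zipWith; lookup; updateAt)
open import Level using (Level; _⊔_)
open import Relation.Binary.Bundles using (Setoid)
open import Relation.Binary.Structures using (IsEquivalence)
open import Relation.Binary.PropositionalEquality.Core as ≡ using (_≡_; _≢_)
open import Relation.Nullary using (¬_; Dec; yes; no; does)

import Algebra.Definitions.RawSemiring as RawSemiringDefs
import Algebra.Properties.Ring as RingProperties
import Algebra.Properties.Semiring.Mult as SemiringMult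
import Algebra.Properties.Semiring.Sum as SemiringSum
import Algebra.Properties.CommutativeSemigroup as CommutativeSemigroupProperties
import Algebra.Consequences.Setoid as Consequences
import Data.Fin.Properties as Fin
import Data.List.Properties as List
import Data.Nat.Properties as ℕ
import Data.Vec.Properties as Vec
import Relation.Binary.Reasoning.Setoid as SetoidReasoning

private
  variable
    c ℓ c′ ℓ′ : Level
    m : ℕ

-- n × b, b ^ n, and finite sums and products, in a ring B.
module RingOps {c ℓ} (B : CommutativeRing c ℓ) =
  RawSemiringDefs (Semiring.rawSemiring (CommutativeRing.semiring B))

module _ (K : CommutativeRing c ℓ) where
  open CommutativeRing K
  open RingOps K using () renaming (_×_ to _·_)

  record IsField : Set (c ⊔ ℓ) where
    field
      1≉0     : ¬ 1# ≈ 0#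
      inverse : ∀ x → ¬ x ≈ 0# → ∃[ y ] x * y ≈ 1#

  CharacteristicZero : Set ℓ
  CharacteristicZero = ∀ n → ¬ suc n · 1# ≈ 0#

-- The monomial t₀^α₀ ⋯ tₘ₋₁^αₘ₋₁ is represented by its exponent vector α.

Monomial : ℕ → Set
Monomial m = Vec ℕ m

infixl 7 _∙_

_∙_ : Monomial m → Monomial m → Monomial m
_∙_ = zipWith ℕ._+_

1ᴹ : Monomial m
1ᴹ = replicate _ 0

generator : Fin m → Monomial m
generator i = updateAt 1ᴹ i suc

infix 4 _≟_

_≟_ : (α β : Monomial m) → Dec (α ≡ β)
_≟_ = Vec.≡-dec ℕ._≟_

private
  ∙-comm : (α β : Monomial m) → α ∙ β ≡ β ∙ α
  ∙-comm = Vec.zipWith-comm ℕ.+-comm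

  ∙-assoc : (α β γ : Monomial m) → (α ∙ β) ∙ γ ≡ α ∙ (β ∙ γ)
  ∙-assoc = Vec.zipWith-assoc ℕ.+-assoc

  ∙-identityˡ : (α : Monomial m) → 1ᴹ ∙ α ≡ α
  ∙-identityˡ = Vec.zipWith-identityˡ ℕ.+-identityˡ

  updateAt-pred-∙ : ∀ (i : Fin m) α β {k} → lookup α i ≡ suc k →
                    updateAt α i pred ∙ β ≡ updateAt (α ∙ β) i pred
  updateAt-pred-∙ Fin.zero    (suc a Vec.∷ α) (b Vec.∷ β) eq = ≡.refl
  updateAt-pred-∙ (Fin.suc i) (a Vec.∷ α)     (b Vec.∷ β) eq =
    ≡.cong (_ Vec.∷_) (updateAt-pred-∙ i α β eq)

module Polynomials (K : CommutativeRing c ℓ) where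
  open CommutativeRing K
  open RingOps K using () renaming (_×_ to _·_)
  private
    module M = SemiringMult semiring
    module RP = RingProperties ring
    module +P = CommutativeSemigroupProperties +-commutativeSemigroup
    module *P = CommutativeSemigroupProperties *-commutativeSemigroup
    open SetoidReasoning setoid

  -- A list of terms (c , α) stands for the formal sum of the c t^α. Monomials
  -- may repeat and coefficients may vanish; _≋_ identifies two lists with the
  -- same coefficients.

  Poly : ℕ → Set c
  Poly m = List (Carrier × Monomial m)

  coeff : Poly m → Monomial m → Carrier
  coeff []            α = 0#
  coeff ((c , β) ∷ p) α = (if does (α ≟ β) then c else 0#) + coeff p α

  infix 4 _≋_

  record _≋_ (p q : Poly m) : Set ℓ where
    constructor mk≋
    field coeff-≈ : ∀ α → coeff p α ≈ coeff q α

  open _≋_ public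

  infixl 6 _⊕_
  infixl 7 _⊛_
  infix  8 ⊖_

  const : Carrier → Poly m
  const c = (c , 1ᴹ) ∷ []

  var : Fin m → Poly m
  var i = (1# , generator i) ∷ []

  _⊕_ : Poly m → Poly m → Poly m
  _⊕_ = _++_

  ⊖_ : Poly m → Poly m
  ⊖_ = map λ (c , α) → - c , α

  _⊛_ : Poly m → Poly m → Poly m
  []            ⊛ q = []
  ((c , α) ∷ p) ⊛ q = map (λ (d , β) → c * d , α ∙ β) q ⊕ p ⊛ q

  -- Truncated subtraction is harmless: a term with αᵢ = 0 gets coefficient 0.
  ∂ : Fin m → Poly m → Poly m
  ∂ i = map λ (c , α) → lookup α i · c , updateAt α i pred

  -- Each f : Monomial m → K extends to a K-linear functional on polynomials;
  -- these functionals detect _≋_, and the ring laws are checked on them.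
  lin : (Monomial m → Carrier) → Poly m → Carrier
  lin f []            = 0#
  lin f ((c , α) ∷ p) = c * f α + lin f p

  lin-cong : ∀ {f g : Monomial m → Carrier} → (∀ α → f α ≈ g α) →
             ∀ p → lin f p ≈ lin g p
  lin-cong f≈g []            = refl
  lin-cong f≈g ((c , α) ∷ p) = +-cong (*-congˡ (f≈g α)) (lin-cong f≈g p)

  lin-0 : ∀ (p : Poly m) → lin (λ _ → 0#) p ≈ 0#
  lin-0 []            = refl
  lin-0 ((c , α) ∷ p) = trans (+-cong (zeroʳ c) (lin-0 p)) (+-identityʳ 0#)

  lin-+ : ∀ (f g : Monomial m → Carrier) p →
          lin (λ α → f α + g α) p ≈ lin f p + lin g p
  lin-+ f g []            = sym (+-identityʳ 0#)
  lin-+ f g ((c , α) ∷ p) = begin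
    c * (f α + g α) + lin (λ α → f α + g α) p  ≈⟨ +-cong (distribˡ _ _ _) (lin-+ f g p) ⟩
    c * f α + c * g α + (lin f p + lin g p)    ≈⟨ +P.interchange _ _ _ _ ⟩
    c * f α + lin f p + (c * g α + lin g p)    ∎

  lin-* : ∀ x (f : Monomial m → Carrier) p → lin (λ α → x * f α) p ≈ x * lin f p
  lin-* x f []            = sym (zeroʳ x)
  lin-* x f ((c , α) ∷ p) = begin
    c * (x * f α) + lin (λ α → x * f α) p  ≈⟨ +-cong (*P.x∙yz≈y∙xz _ _ _) (lin-* x f p) ⟩
    x * (c * f α) + x * lin f p            ≈⟨ distribˡ _ _ _ ⟨
    x * (c * f α + lin f p)                ∎

  lin-⊕ : ∀ (f : Monomial m → Carrier) p q → lin f (p ⊕ q) ≈ lin f p + lin f q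
  lin-⊕ f []            q = sym (+-identityˡ _)
  lin-⊕ f ((c , α) ∷ p) q = trans (+-congˡ (lin-⊕ f p q)) (sym (+-assoc _ _ _))

  lin-⊖ : ∀ (f : Monomial m → Carrier) p → lin f (⊖ p) ≈ - lin f p
  lin-⊖ f []            = sym RP.-0#≈0#
  lin-⊖ f ((c , α) ∷ p) = begin
    - c * f α + lin f (⊖ p)    ≈⟨ +-cong (sym (RP.-‿distribˡ-* _ _)) (lin-⊖ f p) ⟩
    - (c * f α) + - lin f p    ≈⟨ RP.-‿+-comm _ _ ⟩
    - (c * f α + lin f p)      ∎

  lin-const : ∀ (f : Monomial m → Carrier) x → lin f (const x) ≈ x * f 1ᴹ
  lin-const f x = +-identityʳ _

  lin-swap : ∀ (f : Monomial m → Monomial m → Carrier) p q →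
             lin (λ α → lin (f α) q) p ≈ lin (λ β → lin (λ α → f α β) p) q
  lin-swap f []            q = sym (lin-0 q)
  lin-swap f ((c , α) ∷ p) q = begin
    c * lin (f α) q + lin (λ α → lin (f α) q) p
      ≈⟨ +-cong (sym (lin-* c (f α) q)) (lin-swap f p q) ⟩
    lin (λ β → c * f α β) q + lin (λ β → lin (λ α → f α β) p) q
      ≈⟨ lin-+ _ _ q ⟨
    lin (λ β → c * f α β + lin (λ α → f α β) p) q ∎

  lin-shift : ∀ (f : Monomial m → Carrier) x α q →
              lin f (map (λ (d , β) → x * d , α ∙ β) q) ≈ x * lin (λ β → f (α ∙ β)) q
  lin-shift f x α []            = sym (zeroʳ x)
  lin-shift f x α ((d , β) ∷ q) = begin
    x * d * f (α ∙ β) + lin f (map _ q)                    ≈⟨ +-cong (*-assoc _ _ _) (lin-shift f x α q) ⟩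
    x * (d * f (α ∙ β)) + x * lin (λ β → f (α ∙ β)) q      ≈⟨ distribˡ _ _ _ ⟨
    x * (d * f (α ∙ β) + lin (λ β → f (α ∙ β)) q)          ∎

  lin-⊛ : ∀ (f : Monomial m → Carrier) p q →
          lin f (p ⊛ q) ≈ lin (λ α → lin (λ β → f (α ∙ β)) q) p
  lin-⊛ f []            q = refl
  lin-⊛ f ((c , α) ∷ p) q =
    trans (lin-⊕ f (map _ q) (p ⊛ q)) (+-cong (lin-shift f c α q) (lin-⊛ f p q))

  lin-∂ : ∀ (f : Monomial m → Carrier) i p →
          lin f (∂ i p) ≈ lin (λ α → lookup α i · f (updateAt α i pred)) p
  lin-∂ f i []            = refl
  lin-∂ f i ((c , α) ∷ p) =
    +-cong (trans (M.×-assoc-* (lookup α i) _ _) (sym (M.×-comm-* (lookup α i) _ _))) (lin-∂ f i p)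

  δ : Monomial m → Monomial m → Carrier
  δ α β = if does (α ≟ β) then 1# else 0#

  coeff≈lin : ∀ (p : Poly m) α → coeff p α ≈ lin (δ α) p
  coeff≈lin []            α = refl
  coeff≈lin ((c , β) ∷ p) α with α ≟ β
  ... | yes _ = +-cong (sym (*-identityʳ c)) (coeff≈lin p α)
  ... | no  _ = +-cong (sym (zeroʳ c)) (coeff≈lin p α)

  lin⇒≋ : ∀ {p q : Poly m} → (∀ f → lin f p ≈ lin f q) → p ≋ q
  lin⇒≋ {p = p} {q} h = mk≋ λ α →
    trans (coeff≈lin p α) (trans (h (δ α)) (sym (coeff≈lin q α)))

  without : Monomial m → Poly m → Poly m
  without α []            = []
  without α ((c , β) ∷ p) with α ≟ β
  ... | yes _ = without α p
  ... | no  _ = (c , β) ∷ without α p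

  length-without : ∀ α (p : Poly m) → length (without α p) ℕ.≤ length p
  length-without α []            = ℕ.z≤n
  length-without α ((c , β) ∷ p) with α ≟ β
  ... | yes _ = ℕ.m≤n⇒m≤1+n (length-without α p)
  ... | no  _ = ℕ.s≤s (length-without α p)

  lin-without : ∀ (f : Monomial m → Carrier) α p →
                lin f p ≈ coeff p α * f α + lin f (without α p)
  lin-without f α []            = sym (trans (+-congʳ (zeroˡ _)) (+-identityʳ 0#))
  lin-without f α ((c , β) ∷ p) with α ≟ β
  ... | yes ≡.refl = begin
    c * f α + lin f p                                        ≈⟨ +-congˡ (lin-without f α p) ⟩
    c * f α + (coeff p α * f α + lin f (without α p))        ≈⟨ +-assoc _ _ _ ⟨
    c * f α + coeff p α * f α + lin f (without α p)          ≈⟨ +-congʳ (distribʳ _ _ _) ⟨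
    (c + coeff p α) * f α + lin f (without α p)              ∎
  ... | no _ = begin
    c * f β + lin f p                                        ≈⟨ +-congˡ (lin-without f α p) ⟩
    c * f β + (coeff p α * f α + lin f (without α p))        ≈⟨ +P.x∙yz≈y∙xz _ _ _ ⟩
    coeff p α * f α + (c * f β + lin f (without α p))        ≈⟨ +-congʳ (*-congʳ (+-identityˡ _)) ⟨
    (0# + coeff p α) * f α + (c * f β + lin f (without α p)) ∎

  head-without : ∀ x α (p : Poly m) → without α ((x , α) ∷ p) ≡ without α p
  head-without x α p with α ≟ α
  ... | yes _   = ≡.refl
  ... | no  α≢α with () ← α≢α ≡.refl

  lin-vanishes : ∀ k (p : Poly m) → length p ℕ.≤ k → (∀ α → coeff p α ≈ 0#) →
                 ∀ f → lin f p ≈ 0#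
  lin-vanishes k       []                    _             z f = refl
  lin-vanishes (suc k) p@((c , α) ∷ p′) (ℕ.s≤s |p′|≤k) z f = begin
    lin f p                                      ≈⟨ drop f ⟩
    lin f (without α p)                          ≡⟨ ≡.cong (lin f) (head-without c α p′) ⟩
    lin f (without α p′)                         ≈⟨ lin-vanishes k (without α p′) (ℕ.≤-trans (length-without α p′) |p′|≤k) z′ f ⟩
    0#                                           ∎
    where
    drop : ∀ f → lin f p ≈ lin f (without α p)
    drop f = trans (lin-without f α p)
      (trans (+-congʳ (trans (*-congʳ (z α)) (zeroˡ _))) (+-identityˡ _))
    z′ : ∀ β → coeff (without α p′) β ≈ 0#
    z′ β = begin
      coeff (without α p′) β     ≈⟨ coeff≈lin (without α p′) β ⟩
      lin (δ β) (without α p′)   ≡⟨ ≡.cong (lin (δ β)) (head-without c α p′) ⟨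
      lin (δ β) (without α p)    ≈⟨ drop (δ β) ⟨
      lin (δ β) p                ≈⟨ coeff≈lin p β ⟨
      coeff p β                  ≈⟨ z β ⟩
      0#                         ∎

  ≋⇒lin : ∀ {p q : Poly m} → p ≋ q → ∀ f → lin f p ≈ lin f q
  ≋⇒lin {p = p} {q} p≋q f = RP.x∙y⁻¹≈ε⇒x≈y _ _ (trans (sym (lin-⊖′ f)) (lin-vanishes _ (p ⊕ ⊖ q) ℕ.≤-refl z f))
    where
    lin-⊖′ : ∀ f → lin f (p ⊕ ⊖ q) ≈ lin f p - lin f q
    lin-⊖′ f = trans (lin-⊕ f p (⊖ q)) (+-congˡ (lin-⊖ f q))
    z : ∀ α → coeff (p ⊕ ⊖ q) α ≈ 0#
    z α = begin
      coeff (p ⊕ ⊖ q) α            ≈⟨ coeff≈lin (p ⊕ ⊖ q) α ⟩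
      lin (δ α) (p ⊕ ⊖ q)          ≈⟨ lin-⊖′ (δ α) ⟩
      lin (δ α) p - lin (δ α) q    ≈⟨ +-cong (coeff≈lin p α) (-‿cong (coeff≈lin q α)) ⟨
      coeff p α - coeff q α        ≈⟨ RP.x≈y⇒x∙y⁻¹≈ε (coeff-≈ p≋q α) ⟩
      0#                           ∎

  ⊕-cong : ∀ {p p′ q q′ : Poly m} → p ≋ p′ → q ≋ q′ → p ⊕ q ≋ p′ ⊕ q′
  ⊕-cong {p = p} {p′} {q} {q′} p≋p′ q≋q′ = lin⇒≋ λ f → begin
    lin f (p ⊕ q)        ≈⟨ lin-⊕ f p q ⟩
    lin f p + lin f q    ≈⟨ +-cong (≋⇒lin p≋p′ f) (≋⇒lin q≋q′ f) ⟩
    lin f p′ + lin f q′  ≈⟨ lin-⊕ f p′ q′ ⟨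
    lin f (p′ ⊕ q′)      ∎

  ⊕-assoc : ∀ (p q r : Poly m) → (p ⊕ q) ⊕ r ≋ p ⊕ (q ⊕ r)
  ⊕-assoc p q r = lin⇒≋ λ f → reflexive (≡.cong (lin f) (List.++-assoc p q r))

  ⊕-comm : ∀ (p q : Poly m) → p ⊕ q ≋ q ⊕ p
  ⊕-comm p q = lin⇒≋ λ f →
    trans (lin-⊕ f p q) (trans (+-comm _ _) (sym (lin-⊕ f q p)))

  ⊕-identityʳ : ∀ (p : Poly m) → p ⊕ [] ≋ p
  ⊕-identityʳ p = lin⇒≋ λ f → reflexive (≡.cong (lin f) (List.++-identityʳ p))

  ⊖-cong : ∀ {p q : Poly m} → p ≋ q → ⊖ p ≋ ⊖ q
  ⊖-cong {p = p} {q} p≋q = lin⇒≋ λ f →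
    trans (lin-⊖ f p) (trans (-‿cong (≋⇒lin p≋q f)) (sym (lin-⊖ f q)))

  ⊖-inverseʳ : ∀ (p : Poly m) → p ⊕ ⊖ p ≋ []
  ⊖-inverseʳ p = lin⇒≋ λ f →
    trans (lin-⊕ f p (⊖ p)) (trans (+-congˡ (lin-⊖ f p)) (-‿inverseʳ _))

  ⊛-cong : ∀ {p p′ q q′ : Poly m} → p ≋ p′ → q ≋ q′ → p ⊛ q ≋ p′ ⊛ q′
  ⊛-cong {p = p} {p′} {q} {q′} p≋p′ q≋q′ = lin⇒≋ λ f → begin
    lin f (p ⊛ q)                               ≈⟨ lin-⊛ f p q ⟩
    lin (λ α → lin (λ β → f (α ∙ β)) q) p       ≈⟨ lin-cong (λ α → ≋⇒lin q≋q′ _) p ⟩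
    lin (λ α → lin (λ β → f (α ∙ β)) q′) p      ≈⟨ ≋⇒lin p≋p′ _ ⟩
    lin (λ α → lin (λ β → f (α ∙ β)) q′) p′     ≈⟨ lin-⊛ f p′ q′ ⟨
    lin f (p′ ⊛ q′)                             ∎

  ⊛-comm : ∀ (p q : Poly m) → p ⊛ q ≋ q ⊛ p
  ⊛-comm p q = lin⇒≋ λ f → begin
    lin f (p ⊛ q)                             ≈⟨ lin-⊛ f p q ⟩
    lin (λ α → lin (λ β → f (α ∙ β)) q) p     ≈⟨ lin-swap _ p q ⟩
    lin (λ β → lin (λ α → f (α ∙ β)) p) q     ≈⟨ lin-cong (λ β → lin-cong (λ α → reflexive (≡.cong f (∙-comm α β))) p) q ⟩
    lin (λ β → lin (λ α → f (β ∙ α)) p) q     ≈⟨ lin-⊛ f q p ⟨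
    lin f (q ⊛ p)                             ∎

  ⊛-assoc : ∀ (p q r : Poly m) → (p ⊛ q) ⊛ r ≋ p ⊛ (q ⊛ r)
  ⊛-assoc p q r = lin⇒≋ λ f → begin
    lin f ((p ⊛ q) ⊛ r)
      ≈⟨ lin-⊛ f (p ⊛ q) r ⟩
    lin (λ α → lin (λ γ → f (α ∙ γ)) r) (p ⊛ q)
      ≈⟨ lin-⊛ _ p q ⟩
    lin (λ α → lin (λ β → lin (λ γ → f ((α ∙ β) ∙ γ)) r) q) p
      ≈⟨ lin-cong (λ α → lin-cong (λ β → lin-cong (λ γ → reflexive (≡.cong f (∙-assoc α β γ))) r) q) p ⟩
    lin (λ α → lin (λ β → lin (λ γ → f (α ∙ (β ∙ γ))) r) q) p
      ≈⟨ lin-cong (λ α → lin-⊛ (λ β → f (α ∙ β)) q r) p ⟨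
    lin (λ α → lin (λ β → f (α ∙ β)) (q ⊛ r)) p
      ≈⟨ lin-⊛ f p (q ⊛ r) ⟨
    lin f (p ⊛ (q ⊛ r)) ∎

  ⊛-identityˡ : ∀ (p : Poly m) → const 1# ⊛ p ≋ p
  ⊛-identityˡ p = lin⇒≋ λ f → begin
    lin f (const 1# ⊛ p)              ≈⟨ lin-⊛ f (const 1#) p ⟩
    1# * lin (λ β → f (1ᴹ ∙ β)) p + 0#  ≈⟨ +-identityʳ _ ⟩
    1# * lin (λ β → f (1ᴹ ∙ β)) p     ≈⟨ *-identityˡ _ ⟩
    lin (λ β → f (1ᴹ ∙ β)) p          ≈⟨ lin-cong (λ β → reflexive (≡.cong f (∙-identityˡ β))) p ⟩
    lin f p                           ∎

  ⊛-distribʳ : ∀ (p q r : Poly m) → (q ⊕ r) ⊛ p ≋ q ⊛ p ⊕ r ⊛ p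
  ⊛-distribʳ p q r = lin⇒≋ λ f → begin
    lin f ((q ⊕ r) ⊛ p)                 ≈⟨ lin-⊛ f (q ⊕ r) p ⟩
    lin _ (q ⊕ r)                       ≈⟨ lin-⊕ _ q r ⟩
    lin _ q + lin _ r                   ≈⟨ +-cong (lin-⊛ f q p) (lin-⊛ f r p) ⟨
    lin f (q ⊛ p) + lin f (r ⊛ p)       ≈⟨ lin-⊕ f (q ⊛ p) (r ⊛ p) ⟨
    lin f (q ⊛ p ⊕ r ⊛ p)               ∎

  ≋-isEquivalence : IsEquivalence (_≋_ {m})
  ≋-isEquivalence = record
    { refl  = mk≋ λ α → refl
    ; sym   = λ e → mk≋ λ α → sym (coeff-≈ e α)
    ; trans = λ e e′ → mk≋ λ α → trans (coeff-≈ e α) (coeff-≈ e′ α)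
    }

  ≋-setoid : ℕ → Setoid c ℓ
  ≋-setoid m = record { isEquivalence = ≋-isEquivalence {m} }

  private module C (m : ℕ) = Consequences (≋-setoid m)

  polynomialRing : ℕ → CommutativeRing c ℓ
  polynomialRing m = record
    { Carrier = Poly m
    ; _≈_     = _≋_
    ; _+_     = _⊕_
    ; _*_     = _⊛_
    ; -_      = ⊖_
    ; 0#      = []
    ; 1#      = const 1#
    ; isCommutativeRing = record
      { isRing = record
        { +-isAbelianGroup = record
          { isGroup = record
            { isMonoid = record
              { isSemigroup = record
                { isMagma = record
                  { isEquivalence = ≋-isEquivalence
                  ; ∙-cong        = ⊕-cong
                  }
                ; assoc = ⊕-assoc
                }
              ; identity = C.comm∧idʳ⇒id m ⊕-comm ⊕-identityʳ
              }
            ; inverse = C.comm∧invʳ⇒inv m ⊕-comm ⊖-inverseʳ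
            ; ⁻¹-cong = ⊖-cong
            }
          ; comm = ⊕-comm
          }
        ; *-cong     = ⊛-cong
        ; *-assoc    = ⊛-assoc
        ; *-identity = C.comm∧idˡ⇒id m ⊛-comm ⊛-identityˡ
        ; distrib    = C.comm∧distrʳ⇒distr m ⊕-cong ⊛-comm ⊛-distribʳ
        }
      ; *-comm = ⊛-comm
      }
    }

  -- K-linear derivations of the K-algebra K[t₀, …, tₘ₋₁].
  record IsDerivation (D : Poly m → Poly m) : Set (c ⊔ ℓ) where
    field
      cong     : ∀ {p q} → p ≋ q → D p ≋ D q
      additive : ∀ p q → D (p ⊕ q) ≋ D p ⊕ D q
      scalar   : ∀ x p → D (const x ⊛ p) ≋ const x ⊛ D p
      leibniz  : ∀ p q → D (p ⊛ q) ≋ D p ⊛ q ⊕ p ⊛ D q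

  private
    module P (m : ℕ) where
      private module R = CommutativeRing (polynomialRing m)
      open R public
      open SemiringSum R.semiring public
      open CommutativeSemigroupProperties R.+-commutativeSemigroup public using (interchange)
      open CommutativeSemigroupProperties R.*-commutativeSemigroup public using (x∙yz≈y∙xz)

  leibniz-· : ∀ (f : Monomial m → Carrier) i α β →
              lookup (α ∙ β) i · f (updateAt (α ∙ β) i pred) ≈
              lookup α i · f (updateAt α i pred ∙ β) + lookup β i · f (α ∙ updateAt β i pred)
  leibniz-· f i α β = begin
    lookup (α ∙ β) i · f (updateAt (α ∙ β) i pred)
      ≡⟨ ≡.cong (_· f (updateAt (α ∙ β) i pred)) (Vec.lookup-zipWith ℕ._+_ i α β) ⟩
    (lookup α i ℕ.+ lookup β i) · f (updateAt (α ∙ β) i pred)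
      ≈⟨ M.×-homo-+ _ (lookup α i) (lookup β i) ⟩
    lookup α i · f (updateAt (α ∙ β) i pred) + lookup β i · f (updateAt (α ∙ β) i pred)
      ≈⟨ +-cong left right ⟩
    lookup α i · f (updateAt α i pred ∙ β) + lookup β i · f (α ∙ updateAt β i pred) ∎
    where
    left : lookup α i · f (updateAt (α ∙ β) i pred) ≈ lookup α i · f (updateAt α i pred ∙ β)
    left with lookup α i in eq
    ... | zero  = refl
    ... | suc k = M.×-congʳ (suc k) (reflexive (≡.cong f (≡.sym (updateAt-pred-∙ i α β eq))))
    right : lookup β i · f (updateAt (α ∙ β) i pred) ≈ lookup β i · f (α ∙ updateAt β i pred)
    right with lookup β i in eq
    ... | zero  = refl
    ... | suc k = M.×-congʳ (suc k) (reflexive (≡.cong f (≡.trans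
      (≡.cong (λ γ → updateAt γ i pred) (∙-comm α β))
      (≡.trans (≡.sym (updateAt-pred-∙ i β α eq)) (∙-comm _ α)))))

  lin-· : ∀ n (f : Monomial m → Carrier) p → lin (λ α → n · f α) p ≈ n · lin f p
  lin-· zero    f p = lin-0 p
  lin-· (suc n) f p = trans (lin-+ f _ p) (+-congˡ (lin-· n f p))

  ∂-leibniz : ∀ (i : Fin m) p q → ∂ i (p ⊛ q) ≋ ∂ i p ⊛ q ⊕ p ⊛ ∂ i q
  ∂-leibniz i p q = lin⇒≋ λ f → begin
    lin f (∂ i (p ⊛ q))
      ≈⟨ lin-∂ f i (p ⊛ q) ⟩
    lin (λ α → lookup α i · f (updateAt α i pred)) (p ⊛ q)
      ≈⟨ lin-⊛ _ p q ⟩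
    lin (λ α → lin (λ β → lookup (α ∙ β) i · f (updateAt (α ∙ β) i pred)) q) p
      ≈⟨ lin-cong (λ α → trans (lin-cong (leibniz-· f i α) q) (lin-+ _ _ q)) p ⟩
    lin (λ α → lin (λ β → lookup α i · f (updateAt α i pred ∙ β)) q
             + lin (λ β → lookup β i · f (α ∙ updateAt β i pred)) q) p
      ≈⟨ lin-+ _ _ p ⟩
    lin (λ α → lin (λ β → lookup α i · f (updateAt α i pred ∙ β)) q) p
      + lin (λ α → lin (λ β → lookup β i · f (α ∙ updateAt β i pred)) q) p
      ≈⟨ +-cong (lin-cong (λ α → lin-· (lookup α i) _ q) p)
                (lin-cong (λ α → sym (lin-∂ (λ β → f (α ∙ β)) i q)) p) ⟩
    lin (λ α → lookup α i · lin (λ β → f (updateAt α i pred ∙ β)) q) p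
      + lin (λ α → lin (λ β → f (α ∙ β)) (∂ i q)) p
      ≈⟨ +-cong (sym (lin-∂ _ i p)) (sym (lin-⊛ f p (∂ i q))) ⟩
    lin (λ α → lin (λ β → f (α ∙ β)) q) (∂ i p) + lin f (p ⊛ ∂ i q)
      ≈⟨ +-congʳ (lin-⊛ f (∂ i p) q) ⟨
    lin f (∂ i p ⊛ q) + lin f (p ⊛ ∂ i q)
      ≈⟨ lin-⊕ f (∂ i p ⊛ q) (p ⊛ ∂ i q) ⟨
    lin f (∂ i p ⊛ q ⊕ p ⊛ ∂ i q) ∎

  ∂-const : ∀ (i : Fin m) x → ∂ i (const x) ≋ []
  ∂-const i x = lin⇒≋ λ f → begin
    (lookup 1ᴹ i · x) * f _ + 0#  ≈⟨ +-identityʳ _ ⟩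
    (lookup 1ᴹ i · x) * f _       ≡⟨ ≡.cong (λ k → (k · x) * f (updateAt 1ᴹ i pred)) (Vec.lookup-replicate i 0) ⟩
    0# * f _                      ≈⟨ zeroˡ _ ⟩
    0#                            ∎

  ∂-var-≡ : ∀ (i : Fin m) → ∂ i (var i) ≋ const 1#
  ∂-var-≡ i = lin⇒≋ λ f → +-congʳ (*-cong
    (trans (reflexive (≡.cong (_· 1#) (≡.trans (Vec.lookup∘updateAt i 1ᴹ) (≡.cong suc (Vec.lookup-replicate i 0)))))
           (+-identityʳ 1#))
    (reflexive (≡.cong f (≡.trans (Vec.updateAt-updateAt i 1ᴹ) (Vec.updateAt-id i 1ᴹ)))))

  ∂-var-≢ : ∀ (i j : Fin m) → i ≢ j → ∂ i (var j) ≋ []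
  ∂-var-≢ i j i≢j = lin⇒≋ λ f → begin
    (lookup (generator j) i · 1#) * f _ + 0#  ≈⟨ +-identityʳ _ ⟩
    (lookup (generator j) i · 1#) * f _
      ≡⟨ ≡.cong (λ k → (k · 1#) * f (updateAt (generator j) i pred)) (≡.trans (Vec.lookup∘updateAt′ i j i≢j 1ᴹ) (Vec.lookup-replicate i 0)) ⟩
    0# * f _                                  ≈⟨ zeroˡ _ ⟩
    0#                                        ∎

  ∂-isDerivation : ∀ (i : Fin m) → IsDerivation (∂ i)
  ∂-isDerivation {m} i = record
    { cong     = λ {p} {q} p≋q → lin⇒≋ λ f →
        trans (lin-∂ f i p) (trans (≋⇒lin p≋q _) (sym (lin-∂ f i q)))
    ; additive = λ p q → P.reflexive m (List.map-++ _ p q)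
    ; scalar   = λ x p → P.trans m (∂-leibniz i (const x) p)
        (⊕-cong {p′ = []} (⊛-cong (∂-const i x) (P.refl m {p})) (P.refl m))
    ; leibniz  = ∂-leibniz i
    }

  sum-isDerivation : ∀ {k} (D : Fin k → Poly m → Poly m) → (∀ i → IsDerivation (D i)) →
                     IsDerivation (λ p → P.sum m (λ i → D i p))
  sum-isDerivation {m} {zero} D d = record
    { cong     = λ _ → P.refl m
    ; additive = λ _ _ → P.refl m
    ; scalar   = λ x p → P.sym m (P.zeroʳ m (const x))
    ; leibniz  = λ p q → P.sym m (P.zeroʳ m p)
    }
  sum-isDerivation {m} {suc k} D d = record
    { cong     = λ e → ⊕-cong (D₀.cong e) (D₊.cong e)
    ; additive = λ p q → P.trans m (⊕-cong (D₀.additive p q) (D₊.additive p q))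
        (P.interchange m (D Fin.zero p) (D Fin.zero q) (Σ₊ p) (Σ₊ q))
    ; scalar   = λ x p → P.trans m (⊕-cong (D₀.scalar x p) (D₊.scalar x p))
        (P.sym m (P.distribˡ m (const x) (D Fin.zero p) (Σ₊ p)))
    ; leibniz  = λ p q → P.trans m (⊕-cong (D₀.leibniz p q) (D₊.leibniz p q))
        (P.trans m (P.interchange m (D Fin.zero p ⊛ q) (p ⊛ D Fin.zero q) (Σ₊ p ⊛ q) (p ⊛ Σ₊ q))
          (⊕-cong (P.sym m (P.distribʳ m q (D Fin.zero p) (Σ₊ p)))
                  (P.sym m (P.distribˡ m p (D Fin.zero q) (Σ₊ q)))))
    }
    where
    Σ₊ : Poly m → Poly m
    Σ₊ p = P.sum m (λ i → D (Fin.suc i) p)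
    module D₀ = IsDerivation (d Fin.zero)
    module D₊ = IsDerivation (sum-isDerivation (λ i → D (Fin.suc i)) (λ i → d (Fin.suc i)))

  ⊛-congˡ : ∀ (p : Poly m) {q r} → q ≋ r → p ⊛ q ≋ p ⊛ r
  ⊛-congˡ {m} p = ⊛-cong (P.refl m {p})

  *-isDerivation : ∀ v {D : Poly m → Poly m} → IsDerivation D → IsDerivation (λ p → v ⊛ D p)
  *-isDerivation {m} v {D} d = record
    { cong     = λ e → ⊛-congˡ v (cong e)
    ; additive = λ p q → P.trans m (⊛-congˡ v (additive p q)) (P.distribˡ m v (D p) (D q))
    ; scalar   = λ x p → P.trans m (⊛-congˡ v (scalar x p)) (P.x∙yz≈y∙xz m v (const x) (D p))
    ; leibniz  = λ p q → P.trans m (⊛-congˡ v (leibniz p q)) (P.trans m (P.distribˡ m v (D p ⊛ q) (p ⊛ D q))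
        (⊕-cong (P.sym m (P.*-assoc m v (D p) q)) (P.x∙yz≈y∙xz m v p (D q))))
    }
    where open IsDerivation d

  -- The derivation with tᵢ ↦ vᵢ.
  derivation : (Fin m → Poly m) → Poly m → Poly m
  derivation {m} v p = sum λ i → v i ⊛ ∂ i p
    where open RingOps (polynomialRing m) using (sum)

  derivation-isDerivation : ∀ (v : Fin m → Poly m) → IsDerivation (derivation v)
  derivation-isDerivation v = sum-isDerivation _ λ i → *-isDerivation (v i) (∂-isDerivation i)

  derivation-var : ∀ (v : Fin m → Poly m) j → derivation v (var j) ≋ v j
  derivation-var {suc m} v j =
    P.trans m′ (P.sum-remove m′ {i = j} (λ i → v i ⊛ ∂ i (var j)))
    (P.trans m′ (⊕-cong
        (P.trans m′ (⊛-congˡ (v j) (∂-var-≡ j)) (P.*-identityʳ m′ (v j)))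
        (P.trans m′ (P.sum-cong-≋ m′ (λ i → P.trans m′
            (⊛-congˡ (v (Fin.punchIn j i)) (∂-var-≢ _ j (Fin.punchInᵢ≢i j i))) (P.zeroʳ m′ (v (Fin.punchIn j i)))))
          (P.sum-replicate-zero m′ m)))
      (⊕-identityʳ (v j)))
    where m′ = suc m

  -- p(b₀, …, bₘ₋₁) in a ring B over K with structure map ι : K → B.
  evaluate : (B : CommutativeRing c′ ℓ′) → (Carrier → CommutativeRing.Carrier B) →
             Poly m → (Fin m → CommutativeRing.Carrier B) → CommutativeRing.Carrier B
  evaluate B ι []            b = CommutativeRing.0# B
  evaluate B ι ((c , α) ∷ p) b = ι c B.* product (λ i → b i ^ lookup α i) B.+ evaluate B ι p b
    where
    module B = CommutativeRing B
    open RingOps B using (product; _^_)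

  K[x] : CommutativeRing c ℓ
  K[x] = polynomialRing 1

  _′ : Poly 1 → Poly 1
  _′ = ∂ Fin.zero

  _⟨_⟩ : Poly 1 → Carrier → Carrier
  p ⟨ x ⟩ = evaluate K (λ c → c) p (λ _ → x)

  record HasDegree (p : Poly 1) (k : ℕ) : Set ℓ where
    field
      leading : ¬ coeff p (k Vec.∷ Vec.[]) ≈ 0#
      higher  : ∀ j → k ℕ.< j → coeff p (j Vec.∷ Vec.[]) ≈ 0#

  record IsAppell (A : ℕ → Poly 1) : Set ℓ where
    open RingOps K[x] using () renaming (_×_ to _·ₓ_)
    field
      degree : ∀ k → HasDegree (A k) k
      -- At k = 0 the right-hand side is 0.
      appell : ∀ k → A k ′ ≋ k ·ₓ A (pred k)

  -- aᵢ ↦ i aᵢ₋₁ on K[a₀, …, aₙ]; Fin.pred sends zero to zero, where the factor is 0.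
  shift : ∀ n → Fin (suc n) → Poly (suc n)
  shift n i = toℕ i ·ₐ var (Fin.pred i)
    where open RingOps (polynomialRing (suc n)) using () renaming (_×_ to _·ₐ_)

  𝒟 : ∀ n → Poly (suc n) → Poly (suc n)
  𝒟 n = derivation (shift n)

  𝒟-isDerivation : ∀ n → IsDerivation (𝒟 n)
  𝒟-isDerivation n = derivation-isDerivation (shift n)

  𝒟-var : ∀ n i → 𝒟 n (var i) ≋ shift n i
  𝒟-var n = derivation-var (shift n)

  SemiInvariant : ∀ n → Poly (suc n) → Set ℓ
  SemiInvariant n S = 𝒟 n S ≋ []

{-# OPTIONS --safe #-}

-- Substituting aᵢ ↦ Aᵢ(x) turns 𝒟 into d/dx: by the chain rule and Aᵢ′ = i Aᵢ₋₁,
-- the derivative of S(A₀, …, Aₙ) is (𝒟 S)(A₀, …, Aₙ) = 0. In characteristic zero a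
-- polynomial with zero derivative is its value at 0, and evaluation at 0, being a
-- ring homomorphism, commutes with the substitution.

module Submission where

open import Defs
open import Algebra.Bundles using (CommutativeRing; Semiring)
open import Algebra.Morphism.Structures using (IsSemiringHomomorphism)
open import Data.Bool.Base using (true; false)
open import Data.Fin.Base as Fin using (Fin; toℕ)
open import Data.List.Base using ([]; _∷_; map)
open import Data.Nat.Base as ℕ using (ℕ; zero; suc; pred)
open import Data.Product.Base using (_,_; proj₁; proj₂)
open import Data.Unit.Base using (tt)
open import Data.Vec.Base as Vec using (lookup; updateAt)
open import Function.Base using (id; _∘_)
open import Level using (Level)
open import Relation.Binary.PropositionalEquality.Core as ≡ using ()

import Algebra.Morphism.Construct.Identity as Identity
import Algebra.Properties.CommutativeSemigroup as CommutativeSemigroupProperties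
import Algebra.Properties.Ring as RingProperties
import Algebra.Properties.Semiring.Exp as SemiringExp
import Algebra.Properties.Semiring.Mult as SemiringMult
import Algebra.Properties.Semiring.Sum as SemiringSum
import Data.Fin.Properties as Fin
import Data.Nat.Properties as ℕ
import Data.Vec.Properties as Vec
import Relation.Binary.Reasoning.Setoid as SetoidReasoning

private
  variable
    c ℓ c′ ℓ′ c″ ℓ″ : Level
    m : ℕ

-- Preservation of negatives follows for maps between rings, so the semiring laws are enough.
IsHomomorphism : (B : CommutativeRing c ℓ) (C : CommutativeRing c′ ℓ′) →
                 (CommutativeRing.Carrier B → CommutativeRing.Carrier C) → Set _
IsHomomorphism B C = IsSemiringHomomorphism
  (Semiring.rawSemiring (CommutativeRing.semiring B)) (Semiring.rawSemiring (CommutativeRing.semiring C))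

-- Monomials evaluated in a commutative ring.

module Powers (B : CommutativeRing c ℓ) where
  open CommutativeRing B
  open RingOps B using (product; _^_)
  private
    module E = SemiringExp semiring
    module *P = CommutativeSemigroupProperties *-commutativeSemigroup
  open SetoidReasoning setoid

  power : (Fin m → Carrier) → Monomial m → Carrier
  power b α = product λ i → b i ^ lookup α i

  power-∙ : ∀ (b : Fin m → Carrier) α β → power b (α ∙ β) ≈ power b α * power b β
  power-∙ b Vec.[]      Vec.[]      = sym (*-identityˡ 1#)
  power-∙ b (x Vec.∷ α) (y Vec.∷ β) = begin
    b Fin.zero ^ (x ℕ.+ y) * power (b ∘ Fin.suc) (α ∙ β)
      ≈⟨ *-cong (E.^-homo-* _ x y) (power-∙ (b ∘ Fin.suc) α β) ⟩
    b Fin.zero ^ x * b Fin.zero ^ y * (power (b ∘ Fin.suc) α * power (b ∘ Fin.suc) β)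
      ≈⟨ *P.interchange _ _ _ _ ⟩
    b Fin.zero ^ x * power (b ∘ Fin.suc) α * (b Fin.zero ^ y * power (b ∘ Fin.suc) β) ∎

  power-1ᴹ : ∀ (b : Fin m → Carrier) → power b 1ᴹ ≈ 1#
  power-1ᴹ {zero}  b = refl
  power-1ᴹ {suc m} b = trans (*-identityˡ _) (power-1ᴹ (b ∘ Fin.suc))

  power-generator : ∀ (b : Fin m → Carrier) j → power b (generator j) ≈ b j
  power-generator b Fin.zero    = begin
    b Fin.zero * 1# * power (b ∘ Fin.suc) 1ᴹ  ≈⟨ *-cong (*-identityʳ _) (power-1ᴹ (b ∘ Fin.suc)) ⟩
    b Fin.zero * 1#                           ≈⟨ *-identityʳ _ ⟩
    b Fin.zero                                ∎
  power-generator b (Fin.suc j) = trans (*-identityˡ _) (power-generator (b ∘ Fin.suc) j)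

-- Polynomials evaluated in a ring over `K`.

module Evaluation
  (K : CommutativeRing c ℓ) (B : CommutativeRing c′ ℓ′)
  (ι : CommutativeRing.Carrier K → CommutativeRing.Carrier B)
  (ι-homo : IsHomomorphism K B ι)
  where

  private
    module K = CommutativeRing K
    module ι = IsSemiringHomomorphism ι-homo
    open RingOps K using () renaming (_×_ to _·ᴷ_)
  open Polynomials K
  open CommutativeRing B
  open RingOps B using (sum; _^_) renaming (_×_ to _·_)
  open Powers B
  private
    module M = SemiringMult semiring
    module S = SemiringSum semiring
    module RP = RingProperties ring
    module *P = CommutativeSemigroupProperties *-commutativeSemigroup
  open SetoidReasoning setoid

  eval : (Fin m → Carrier) → Poly m → Carrier
  eval b p = evaluate B ι p b

  ι-· : ∀ k x → ι (k ·ᴷ x) ≈ k · ι x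
  ι-· zero    x = ι.0#-homo
  ι-· (suc k) x = trans (ι.+-homo x (k ·ᴷ x)) (+-congˡ (ι-· k x))

  -- In the chain rule, `∂ i` multiplies the coefficient by the exponent, whereas differentiating a
  -- power puts that multiple on the monomial; this moves it across.
  ι-·-* : ∀ k x y → ι (k ·ᴷ x) * y ≈ ι x * (k · y)
  ι-·-* k x y = begin
    ι (k ·ᴷ x) * y  ≈⟨ *-congʳ (ι-· k x) ⟩
    k · ι x * y     ≈⟨ M.×-assoc-* k _ _ ⟩
    k · (ι x * y)   ≈⟨ M.×-comm-* k _ _ ⟨
    ι x * (k · y)   ∎

  eval-⊕ : ∀ (b : Fin m → Carrier) p q → eval b (p ⊕ q) ≈ eval b p + eval b q
  eval-⊕ b []            q = sym (+-identityˡ _)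
  eval-⊕ b ((x , α) ∷ p) q = trans (+-congˡ (eval-⊕ b p q)) (sym (+-assoc _ _ _))

  -- The mapped list is what `⊛` forms from a single term of its left factor, so this is the
  -- one-term case of `eval-⊛`.
  eval-shift : ∀ (b : Fin m → Carrier) x α q →
               eval b (map (λ (d , β) → x K.* d , α ∙ β) q) ≈ ι x * power b α * eval b q
  eval-shift b x α []            = sym (zeroʳ _)
  eval-shift b x α ((d , β) ∷ q) = begin
    ι (x K.* d) * power b (α ∙ β) + eval b (map _ q)
      ≈⟨ +-cong (*-cong (ι.*-homo x d) (power-∙ b α β)) (eval-shift b x α q) ⟩
    ι x * ι d * (power b α * power b β) + ι x * power b α * eval b q
      ≈⟨ +-congʳ (*P.interchange _ _ _ _) ⟩
    ι x * power b α * (ι d * power b β) + ι x * power b α * eval b q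
      ≈⟨ distribˡ _ _ _ ⟨
    ι x * power b α * (ι d * power b β + eval b q) ∎

  eval-⊛ : ∀ (b : Fin m → Carrier) p q → eval b (p ⊛ q) ≈ eval b p * eval b q
  eval-⊛ b []            q = sym (zeroˡ _)
  eval-⊛ b ((x , α) ∷ p) q = begin
    eval b (map _ q ⊕ p ⊛ q)                           ≈⟨ eval-⊕ b (map _ q) (p ⊛ q) ⟩
    eval b (map _ q) + eval b (p ⊛ q)                  ≈⟨ +-cong (eval-shift b x α q) (eval-⊛ b p q) ⟩
    ι x * power b α * eval b q + eval b p * eval b q   ≈⟨ distribʳ _ _ _ ⟨
    (ι x * power b α + eval b p) * eval b q            ∎

  eval-const : ∀ (b : Fin m → Carrier) x → eval b (const x) ≈ ι x
  eval-const b x = trans (+-identityʳ _) (trans (*-congˡ (power-1ᴹ b)) (*-identityʳ _))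

  eval-var : ∀ (b : Fin m → Carrier) j → eval b (var j) ≈ b j
  eval-var b j = begin
    ι K.1# * power b (generator j) + 0#  ≈⟨ +-identityʳ _ ⟩
    ι K.1# * power b (generator j)       ≈⟨ *-cong ι.1#-homo (power-generator b j) ⟩
    1# * b j                             ≈⟨ *-identityˡ _ ⟩
    b j                                  ∎

  eval-sum : ∀ {k} (b : Fin m → Carrier) (p : Fin k → Poly m) →
             eval b (RingOps.sum (polynomialRing m) p) ≈ sum (eval b ∘ p)
  eval-sum {k = zero}  b p = refl
  eval-sum {k = suc k} b p = trans (eval-⊕ b (p Fin.zero) _) (+-congˡ (eval-sum b (p ∘ Fin.suc)))

  eval-· : ∀ (b : Fin m → Carrier) k p →
           eval b (RingOps._×_ (polynomialRing m) k p) ≈ k · eval b p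
  eval-· b zero    p = refl
  eval-· b (suc k) p = trans (eval-⊕ b p _) (+-congˡ (eval-· b k p))

  -- The result has the shape of `chainRule`, with `eval b (v i)` in place of `D (b i)`, so the two
  -- can be compared summand by summand.
  eval-derivation : ∀ (b : Fin m → Carrier) v p →
                    eval b (derivation v p) ≈ sum λ i → eval b (v i) * eval b (∂ i p)
  eval-derivation b v p = trans (eval-sum b (λ i → v i ⊛ ∂ i p))
    (S.sum-cong-≋ λ i → eval-⊛ b (v i) (∂ i p))

  -- The chain rule for a derivation `D` of `B` that is linear over `K`.

  module ChainRule
    (D        : Carrier → Carrier)
    (D-cong   : ∀ {x y} → x ≈ y → D x ≈ D y)
    (additive : ∀ x y → D (x + y) ≈ D x + D y)
    (scalar   : ∀ x y → D (ι x * y) ≈ ι x * D y)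
    (leibniz  : ∀ x y → D (x * y) ≈ D x * y + x * D y)
    where

    D-0 : D 0# ≈ 0#
    D-0 = begin
      D 0#                   ≈⟨ D-cong (zeroˡ 0#) ⟨
      D (0# * 0#)            ≈⟨ leibniz 0# 0# ⟩
      D 0# * 0# + 0# * D 0#  ≈⟨ +-cong (zeroʳ _) (zeroˡ _) ⟩
      0# + 0#                ≈⟨ +-identityʳ 0# ⟩
      0#                     ∎

    -- Leibniz on `1# * 1#` gives `D 1# + D 1#`, and one copy cancels.
    D-1 : D 1# ≈ 0#
    D-1 = RP.+-identityʳ-unique (D 1#) (D 1#) (sym (begin
      D 1#                   ≈⟨ D-cong (*-identityˡ 1#) ⟨
      D (1# * 1#)            ≈⟨ leibniz 1# 1# ⟩
      D 1# * 1# + 1# * D 1#  ≈⟨ +-cong (*-identityʳ _) (*-identityˡ _) ⟩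
      D 1# + D 1#            ∎))

    D-^ : ∀ x k → D (x ^ k) ≈ D x * (k · x ^ pred k)
    D-^ x zero    = trans D-1 (sym (zeroʳ _))
    D-^ x (suc k) = begin
      D (x * x ^ k)                                  ≈⟨ leibniz x (x ^ k) ⟩
      D x * x ^ k + x * D (x ^ k)                    ≈⟨ +-congˡ (*-congˡ (D-^ x k)) ⟩
      D x * x ^ k + x * (D x * (k · x ^ pred k))     ≈⟨ +-congˡ (*P.x∙yz≈y∙xz _ _ _) ⟩
      D x * x ^ k + D x * (x * (k · x ^ pred k))     ≈⟨ distribˡ _ _ _ ⟨
      D x * (x ^ k + x * (k · x ^ pred k))           ≈⟨ *-congˡ (+-congˡ (raise k)) ⟩
      D x * (x ^ k + k · x ^ k)                      ∎
      where
      -- Truncation matters only at `k = 0`, where `x * x ^ pred k` is not `x ^ k`; there the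
      -- multiple 0 makes both sides vanish.
      raise : ∀ k → x * (k · x ^ pred k) ≈ k · x ^ k
      raise zero    = zeroʳ x
      raise (suc k) = M.×-comm-* (suc k) x (x ^ k)

    -- Splitting off the first variable, the two Leibniz terms become the head and the tail of the
    -- sum.
    D-power : ∀ (b : Fin m → Carrier) α →
              D (power b α) ≈ sum λ i → D (b i) * (lookup α i · power b (updateAt α i pred))
    D-power b Vec.[]      = D-1
    D-power {suc m} b (a Vec.∷ α) = begin
      D (b₀ ^ a * power b₊ α)
        ≈⟨ leibniz _ _ ⟩
      D (b₀ ^ a) * power b₊ α + b₀ ^ a * D (power b₊ α)
        ≈⟨ +-cong (*-congʳ (D-^ b₀ a)) (*-congˡ (D-power b₊ α)) ⟩
      D b₀ * (a · b₀ ^ pred a) * power b₊ α + b₀ ^ a * sum f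
        ≈⟨ +-cong (trans (*-assoc _ _ _) (*-congˡ (M.×-assoc-* a _ _)))
                  -- Lowering a later exponent leaves the first one alone, so `b₀ ^ a` can be
                  -- absorbed into every monomial of the tail.
                  (trans (S.*-distribˡ-sum (b₀ ^ a) f) (S.sum-cong-≋ {m} λ i →
                    trans (*P.x∙yz≈y∙xz _ _ _) (*-congˡ (M.×-comm-* (lookup α i) _ _)))) ⟩
      D b₀ * (a · (b₀ ^ pred a * power b₊ α)) + sum (λ i → D (b₊ i) * (lookup α i · (b₀ ^ a * P i))) ∎
      where
      b₀ = b Fin.zero
      b₊ = b ∘ Fin.suc
      P f : Fin m → Carrier
      P i = power b₊ (updateAt α i pred)
      f i = D (b₊ i) * (lookup α i · P i)

    -- Linearity of `D` reduces this to monomials, where it is `D-power`; since `∂ i` acts term by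
    -- term, the sums recombine variable by variable.
    chainRule : ∀ (b : Fin m → Carrier) p → D (eval b p) ≈ sum λ i → D (b i) * eval b (∂ i p)
    chainRule {m} b [] = trans D-0 (sym (trans (S.sum-cong-≋ {m} λ i → zeroʳ _) (S.sum-replicate-zero m)))
    chainRule {m} b ((x , α) ∷ p) = begin
      D (ι x * power b α + eval b p)
        ≈⟨ additive _ _ ⟩
      D (ι x * power b α) + D (eval b p)
        ≈⟨ +-cong (trans (scalar x _) (*-congˡ (D-power b α))) (chainRule b p) ⟩
      ι x * sum f + sum g
        ≈⟨ +-congʳ (S.*-distribˡ-sum (ι x) f) ⟩
      sum (λ i → ι x * f i) + sum g
        ≈⟨ S.∑-distrib-+ (λ i → ι x * f i) g ⟨
      sum (λ i → ι x * f i + g i)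
        ≈⟨ S.sum-cong-≋ {m} (λ i → trans
             (+-congʳ (trans (*P.x∙yz≈y∙xz _ _ _) (*-congˡ (sym (ι-·-* (lookup α i) x _)))))
             (sym (distribˡ _ _ _))) ⟩
      sum (λ i → D (b i) * (ι (lookup α i ·ᴷ x) * P i + eval b (∂ i p))) ∎
      where
      P f g : Fin m → Carrier
      P i = power b (updateAt α i pred)
      f i = D (b i) * (lookup α i · P i)
      g i = D (b i) * eval b (∂ i p)

-- Naturality of evaluation under ring homomorphisms.

module Naturality
  (K : CommutativeRing c ℓ) (B : CommutativeRing c′ ℓ′) (C : CommutativeRing c″ ℓ″)
  (h : CommutativeRing.Carrier B → CommutativeRing.Carrier C)
  (h-homo : IsHomomorphism B C h)
  where

  private
    module B = CommutativeRing B
    module h = IsSemiringHomomorphism h-homo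
    module PB = Powers B
    module PC = Powers C
    open RingOps B using () renaming (_^_ to _^ᴮ_)
  open Polynomials K
  open CommutativeRing C
  open RingOps C using (_^_)

  ^-natural : ∀ x k → h (x ^ᴮ k) ≈ h x ^ k
  ^-natural x zero    = h.1#-homo
  ^-natural x (suc k) = trans (h.*-homo x (x ^ᴮ k)) (*-congˡ (^-natural x k))

  power-natural : ∀ (b : Fin m → B.Carrier) α → h (PB.power b α) ≈ PC.power (h ∘ b) α
  power-natural b Vec.[]      = h.1#-homo
  power-natural b (a Vec.∷ α) = trans (h.*-homo _ _)
    (*-cong (^-natural (b Fin.zero) a) (power-natural (b ∘ Fin.suc) α))

  -- `h` carries `ι` to `κ` and preserves the sums, products and powers from which values are built.
  -- The case needed is evaluation at 0 on `K[x]`.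
  evaluate-natural : ∀ {ι κ} → (∀ x → h (ι x) ≈ κ x) → ∀ (p : Poly m) (b : Fin m → B.Carrier) →
                     h (evaluate B ι p b) ≈ evaluate C κ p (h ∘ b)
  evaluate-natural hι≈κ []            b = h.0#-homo
  evaluate-natural hι≈κ ((x , α) ∷ p) b = trans (h.+-homo _ _) (+-cong
    (trans (h.*-homo _ _) (*-cong (hι≈κ x) (power-natural b α)))
    (evaluate-natural hι≈κ p b))

-- Constants and substitutions as maps that respect `_≋_`.

module _ (K : CommutativeRing c ℓ) where
  open Polynomials K
  open CommutativeRing K
  open RingOps K using () renaming (_×_ to _·_)
  private
    module M = SemiringMult semiring
  open SetoidReasoning setoid

  const-isHomomorphism : ∀ m → IsHomomorphism K (polynomialRing m) const
  const-isHomomorphism m = record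
    { isNearSemiringHomomorphism = record
      { +-isMonoidHomomorphism = record
        { isMagmaHomomorphism = record
          { isRelHomomorphism = record { cong = λ x≈y → lin⇒≋ λ f → +-congʳ (*-congʳ x≈y) }
          -- One side is a list of one term and the other of two, so they agree only up to `_≋_`,
          -- which is tested on functionals.
          ; homo = λ x y → lin⇒≋ λ f → begin
              (x + y) * f 1ᴹ + 0#            ≈⟨ +-identityʳ _ ⟩
              (x + y) * f 1ᴹ                 ≈⟨ distribʳ _ _ _ ⟩
              x * f 1ᴹ + y * f 1ᴹ            ≈⟨ +-congˡ (+-identityʳ _) ⟨
              x * f 1ᴹ + (y * f 1ᴹ + 0#)     ∎
          }
        ; ε-homo = lin⇒≋ λ f → trans (+-identityʳ _) (zeroˡ _)
        }
      ; *-homo = λ x y → lin⇒≋ λ f →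
          +-congʳ (*-congˡ (reflexive (≡.cong f (≡.sym (Vec.zipWith-identityˡ ℕ.+-identityˡ 1ᴹ)))))
      }
    ; 1#-homo = lin⇒≋ λ f → refl
    }

  -- `p ⟨ x ⟩` is the one-variable case `EvalK.eval (λ _ → x) p`.
  module EvalK = Evaluation K K id (Identity.isSemiringHomomorphism (Semiring.rawSemiring semiring) refl)

  -- Substitution into K itself is a functional lin f, so it respects _≋_.
  evaluate-isHomomorphism : ∀ (b : Fin m → Carrier) →
    IsHomomorphism (polynomialRing m) K (EvalK.eval b)
  evaluate-isHomomorphism {m} b = record
    { isNearSemiringHomomorphism = record
      { +-isMonoidHomomorphism = record
        { isMagmaHomomorphism = record
          { isRelHomomorphism = record { cong = λ {p} {q} p≋q → begin
              EvalK.eval b p     ≈⟨ eval≈lin p ⟩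
              lin (power b) p    ≈⟨ ≋⇒lin p≋q (power b) ⟩
              lin (power b) q    ≈⟨ eval≈lin q ⟨
              EvalK.eval b q     ∎ }
          ; homo = EvalK.eval-⊕ b
          }
        ; ε-homo = refl
        }
      ; *-homo = EvalK.eval-⊛ b
      }
    ; 1#-homo = EvalK.eval-const b 1#
    }
    where
    open Powers K using (power)
    eval≈lin : ∀ p → EvalK.eval b p ≈ lin (power b) p
    eval≈lin []            = refl
    eval≈lin ((x , α) ∷ p) = +-congˡ (eval≈lin p)

  module _ {k : ℕ} where
    open Powers (polynomialRing k) using (power)

    -- For fixed `g`, substitution followed by `lin g` is itself a functional of `p`. Functionals
    -- respect `_≋_`, hence so does the substitution.
    lin-evaluate : ∀ g (a : Fin m → Poly k) p →
                   lin g (evaluate (polynomialRing k) const p a) ≈ lin (λ α → lin g (power a α)) p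
    lin-evaluate g a []            = refl
    lin-evaluate g a ((x , α) ∷ p) = begin
      lin g (const x ⊛ power a α ⊕ evaluate (polynomialRing k) const p a)
        ≈⟨ lin-⊕ g (const x ⊛ power a α) _ ⟩
      lin g (const x ⊛ power a α) + lin g (evaluate (polynomialRing k) const p a)
        ≈⟨ +-cong (scale (power a α)) (lin-evaluate g a p) ⟩
      x * lin g (power a α) + lin (λ α → lin g (power a α)) p ∎
      where
      scale : ∀ q → lin g (const x ⊛ q) ≈ x * lin g q
      scale q = begin
        lin g (const x ⊛ q)                       ≈⟨ lin-⊛ g (const x) q ⟩
        x * lin (λ β → g (1ᴹ ∙ β)) q + 0#         ≈⟨ +-identityʳ _ ⟩
        x * lin (λ β → g (1ᴹ ∙ β)) q
          ≈⟨ *-congˡ (lin-cong (λ β → reflexive (≡.cong g (Vec.zipWith-identityˡ ℕ.+-identityˡ β))) q) ⟩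
        x * lin g q                               ∎

    evaluate-cong : ∀ (a : Fin m → Poly k) {p q} → p ≋ q →
                    evaluate (polynomialRing k) const p a ≋ evaluate (polynomialRing k) const q a
    evaluate-cong a {p} {q} p≋q = lin⇒≋ λ g →
      trans (lin-evaluate g a p) (trans (≋⇒lin p≋q _) (sym (lin-evaluate g a q)))

  -- Coefficients of a derivative and the value at 0.

  coeff-′ : ∀ p k → coeff (p ′) (k Vec.∷ Vec.[]) ≈ suc k · coeff p (suc k Vec.∷ Vec.[])
  coeff-′ p k = begin
    coeff (p ′) (k Vec.∷ Vec.[])                        ≈⟨ coeff≈lin (p ′) _ ⟩
    lin (δ (k Vec.∷ Vec.[])) (p ′)                      ≈⟨ lin-∂ _ Fin.zero p ⟩
    lin _ p                                             ≈⟨ lin-cong δ-′ p ⟩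
    lin (λ α → suc k · δ (suc k Vec.∷ Vec.[]) α) p      ≈⟨ lin-· (suc k) _ p ⟩
    suc k · lin (δ (suc k Vec.∷ Vec.[])) p              ≈⟨ M.×-congʳ (suc k) (coeff≈lin p _) ⟨
    suc k · coeff p (suc k Vec.∷ Vec.[])                ∎
    where
    ·-0 : ∀ n → n · 0# ≈ 0#
    ·-0 zero    = refl
    ·-0 (suc n) = trans (+-identityˡ _) (·-0 n)
    δ-′ : ∀ α → lookup α Fin.zero · δ (k Vec.∷ Vec.[]) (updateAt α Fin.zero pred)
              ≈ suc k · δ (suc k Vec.∷ Vec.[]) α
    -- For `k = 0` the truncated exponent would match, but the factor 0 removes the term.
    δ-′ (zero  Vec.∷ Vec.[]) = sym (·-0 (suc k))
    -- The test `suc k ≡ᵇ suc a` reduces to `k ≡ᵇ a`, so one case split decides both deltas.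
    δ-′ (suc a Vec.∷ Vec.[]) with k ℕ.≡ᵇ a | ℕ.≡ᵇ⇒≡ k a
    ... | true  | k≡a = M.×-congˡ (≡.cong suc (≡.sym (k≡a tt)))
    ... | false | _   = trans (·-0 (suc a)) (sym (·-0 (suc k)))

  -- As `0# ^ 0` is `1#` and higher powers of `0#` vanish, only the constant terms survive at 0.
  coeff-0 : ∀ p → coeff p (0 Vec.∷ Vec.[]) ≈ p ⟨ 0# ⟩
  coeff-0 []                             = refl
  coeff-0 ((x , zero  Vec.∷ Vec.[]) ∷ p) =
    +-cong (sym (trans (*-congˡ (*-identityˡ 1#)) (*-identityʳ x))) (coeff-0 p)
  coeff-0 ((x , suc a Vec.∷ Vec.[]) ∷ p) =
    +-cong (sym (trans (*-congˡ (trans (*-assoc _ _ _) (zeroˡ _))) (zeroʳ x))) (coeff-0 p)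

  -- Polynomials with zero derivative over a field of characteristic zero.

  module _ (isField : IsField K) (char0 : CharacteristicZero K) where

    -- Characteristic zero makes `suc k · 1#` non-zero, and the field supplies its inverse.
    ·-cancel : ∀ k x → suc k · x ≈ 0# → x ≈ 0#
    ·-cancel k x kx≈0 = begin
      x                             ≈⟨ *-identityʳ x ⟨
      x * 1#                        ≈⟨ *-congˡ (proj₂ inv) ⟨
      x * (suc k · 1# * proj₁ inv)  ≈⟨ *-assoc _ _ _ ⟨
      x * (suc k · 1#) * proj₁ inv  ≈⟨ *-congʳ (M.×-comm-* (suc k) x 1#) ⟩
      suc k · (x * 1#) * proj₁ inv  ≈⟨ *-congʳ (M.×-congʳ (suc k) (*-identityʳ x)) ⟩
      suc k · x * proj₁ inv         ≈⟨ *-congʳ kx≈0 ⟩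
      0# * proj₁ inv                ≈⟨ zeroˡ _ ⟩
      0#                            ∎
      where inv = IsField.inverse isField (suc k · 1#) (char0 k)

    -- The coefficient of degree `suc k`, multiplied by `suc k`, is a coefficient of `p ′` and can
    -- be cancelled; the one of degree 0 is the value at 0.
    ′-zero⇒const : ∀ p → p ′ ≋ [] → p ≋ const (p ⟨ 0# ⟩)
    ′-zero⇒const p p′≋0 = mk≋ λ where
      (zero  Vec.∷ Vec.[]) → trans (coeff-0 p) (sym (+-identityʳ _))
      (suc k Vec.∷ Vec.[]) → trans
        (·-cancel k _ (trans (sym (coeff-′ p k)) (coeff-≈ p′≋0 (k Vec.∷ Vec.[]))))
        (sym (+-identityʳ 0#))

  -- Substitution of Appell polynomials.

  module _ (A : ℕ → Poly 1) (appell : IsAppell A) (n : ℕ) where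
    private
      module R = CommutativeRing K[x]
      module RS = SemiringSum R.semiring
      module RM = SemiringMult R.semiring
      module E = Evaluation K K[x] const (const-isHomomorphism 1)
      open RingOps K[x] using () renaming (_×_ to _·ₓ_)
      module ∂′ = IsDerivation (∂-isDerivation {1} Fin.zero)

      a : Fin (suc n) → Poly 1
      a i = A (toℕ i)

    -- The Appell condition enters here: the image of `i aᵢ₋₁` is `i Aᵢ₋₁`, the derivative of `Aᵢ`.
    evaluate-shift : ∀ i → E.eval a (shift n i) ≋ a i ′
    evaluate-shift i = R.trans (E.eval-· a (toℕ i) (var (Fin.pred i)))
      (R.trans (RM.×-congʳ (toℕ i) (E.eval-var a (Fin.pred i)))
        (R.trans (toℕ-pred i) (R.sym (IsAppell.appell appell (toℕ i)))))
      where
      toℕ-pred : ∀ i → toℕ i ·ₓ a (Fin.pred i) ≋ toℕ i ·ₓ A (pred (toℕ i))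
      toℕ-pred Fin.zero    = R.refl
      -- `Fin.pred (Fin.suc i)` is `inject₁ i`, whose underlying number is that of `i`.
      toℕ-pred (Fin.suc i) = R.reflexive (≡.cong (λ j → suc (toℕ i) ·ₓ A j) (Fin.toℕ-inject₁ i))

    -- Both sides expand into sums over the values of `∂ i S`, whose factors agree by
    -- `evaluate-shift`.
    evaluate-′ : ∀ S → E.eval a S ′ ≋ E.eval a (𝒟 n S)
    evaluate-′ S = R.trans
      (E.ChainRule.chainRule _′ ∂′.cong ∂′.additive ∂′.scalar ∂′.leibniz a S)
      (R.sym (R.trans (E.eval-derivation a (shift n) S)
        (RS.sum-cong-≋ λ i → ⊛-cong (evaluate-shift i) (R.refl {E.eval a (∂ i S)}))))

mainTheorem2 : ∀ {c ℓ} (K : CommutativeRing c ℓ) → IsField K → CharacteristicZero K →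
    let open CommutativeRing K using (0#)
        open Polynomials K
    in (A : ℕ → Poly 1) → IsAppell A →
       (n : ℕ) (S : Poly (suc n)) → SemiInvariant n S →
       evaluate K[x] const S (λ i → A (toℕ i))
         ≋ const (evaluate K (λ c → c) S (λ i → A (toℕ i) ⟨ 0# ⟩))
mainTheorem2 K isField char0 A appell n S 𝒟S≋0 =
  R.trans (′-zero⇒const K isField char0 φS φS′≋0)
    -- The constant is `φS ⟨ 0# ⟩`; evaluation at 0 is a homomorphism fixing scalars, so it passes
    -- inside `S`.
    (IsSemiringHomomorphism.⟦⟧-cong (const-isHomomorphism K 1)
      (Naturality.evaluate-natural K K[x] K (_⟨ 0# ⟩)
        (evaluate-isHomomorphism K {1} (λ _ → 0#)) (EvalK.eval-const K {1} (λ _ → 0#)) S a))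
  where
  open CommutativeRing K using (0#)
  open Polynomials K
  module R = CommutativeRing K[x]
  a : Fin (suc n) → Poly 1
  a i = A (toℕ i)
  φS = evaluate K[x] const S a
  φS′≋0 : φS ′ ≋ []
  -- Semi-invariance holds only up to `_≋_`, hence the appeal to `evaluate-cong`; the value of `[]`
  -- is zero by computation.
  φS′≋0 = R.trans (evaluate-′ K A appell n S) (evaluate-cong K a 𝒟S≋0)
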